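{- Let $r\in\{2,3\}$ and let $\alpha\ge 1$ be an integer. Then $g(r,2,\alpha)=r\alpha$. In particular, there exist a graph $G$ with $\alpha(G)=\alpha$ and a coloring of its edges with $r$ colors such that $V(G)$ cannot be covered by the vertex sets of $r\alpha-1$ monochromatic subgraphs of $G$, each of diameter at most $2$.
   Context: Graphs are finite and simple; $\alpha(G)$ is the independence number. A monochromatic subgraph is a subgraph (not necessarily induced) all of whose edges have the same color; a single vertex counts as a monochromatic subgraph. Different subgraphs in a cover may have different colors, and need not be disjoint or distinct. The diameter of a graph $H$ is the smallest integer $d$ with $d_H(u,v)\le d$ for all $u,v\in V(H)$, where distances are measured in $H$ itself ($\infty$ if there is no path); a one-vertex graph has diameter $0$. $g(r,d,\alpha)$ denotes the minimum $k$ such that for every graph $G$ with $\alpha(G)=\alpha$ and every coloring of the edges of $G$ with $r$ colors, $V(G)$ can be covered by the vertex sets of $k$ monochromatic subgraphs of diameter at most $d$. -}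

module Defs where

open import Data.Nat using (ℕ; zero; suc; _≤_)
open import Data.Fin using (Fin)
open import Data.Fin.Subset using (Subset; _∈_; ∣_∣; Nonempty)
open import Data.Product using (Σ; ∃; _×_)
open import Level using (Level; 0ℓ)
open import Relation.Binary.Core using (Rel)
open import Relation.Binary.Definitions using (Symmetric; Decidable)
open import Relation.Binary.PropositionalEquality using (_≡_)
open import Relation.Nullary using (¬_)

private
  variable
    ℓ : Level
    n r : ℕ

Least : (ℕ → Set ℓ) → ℕ → Set ℓ
Least P k = P k × (∀ j → P j → k ≤ j)

-- Finite simple graphs with vertex set Fin n.
record Graph (n : ℕ) : Set₁ where
  field
    Adj      : Rel (Fin n) 0ℓ
    adj?     : Decidable Adj
    adj-sym  : Symmetric Adj
    adj-irr  : ∀ {v} → ¬ Adj v v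

open Graph public

Independent : Graph n → Subset n → Set
Independent G S = ∀ {u v} → u ∈ S → v ∈ S → ¬ Adj G u v

IsIndependenceNumber : Graph n → ℕ → Set
IsIndependenceNumber {n} G a =
  (Σ (Subset n) λ S → Independent G S × ∣ S ∣ ≡ a) ×
  (∀ S → Independent G S → ∣ S ∣ ≤ a)

-- colour-sym quantifies over all proofs p and q, so that the colour depends
-- only on the unordered pair {u , v} and not on the proof of adjacency.
-- Not all r colours need to occur.
record Colouring (G : Graph n) (r : ℕ) : Set where
  field
    colour     : ∀ {u v} → Adj G u v → Fin r
    colour-sym : ∀ {u v} (p : Adj G u v) (q : Adj G v u) → colour p ≡ colour q

open Colouring public

record Subgraph (G : Graph n) : Set₁ where
  field
    vertices : Subset n
    nonempty : Nonempty vertices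
    Edge     : Rel (Fin n) 0ℓ
    edge?    : Decidable Edge
    edge-sym : Symmetric Edge
    edge-end : ∀ {u v} → Edge u v → u ∈ vertices × v ∈ vertices
    edge-adj : ∀ {u v} → Edge u v → Adj G u v

open Subgraph public

Monochromatic : {G : Graph n} → Colouring G r → Subgraph G → Set
Monochromatic c H =
  ∀ {u v x y} (e : Edge H u v) (f : Edge H x y) →
  colour c (edge-adj H e) ≡ colour c (edge-adj H f)

data Walk {n} {G : Graph n} (H : Subgraph G) : Fin n → Fin n → ℕ → Set where
  []  : ∀ {v} → v ∈ vertices H → Walk H v v zero
  _∷_ : ∀ {u v w l} → Edge H u v → Walk H v w l → Walk H u w (suc l)

-- Distances and diameters are relations rather than functions: when the
-- value is infinite, no natural number is related.
IsDistance : {G : Graph n} → Subgraph G → Fin n → Fin n → ℕ → Set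
IsDistance H u v = Least (Walk H u v)

DistanceAtMost : {G : Graph n} → Subgraph G → Fin n → Fin n → ℕ → Set
DistanceAtMost H u v d = ∃ λ k → IsDistance H u v k × k ≤ d

IsDiameter : {G : Graph n} → Subgraph G → ℕ → Set
IsDiameter H = Least λ d →
  ∀ u v → u ∈ vertices H → v ∈ vertices H → DistanceAtMost H u v d

DiameterAtMost : {G : Graph n} → Subgraph G → ℕ → Set
DiameterAtMost H d = ∃ λ k → IsDiameter H k × k ≤ d

-- The k subgraphs are indexed by Fin k, hence may overlap or coincide.
CoverableBy : {G : Graph n} → Colouring G r → (d k : ℕ) → Set₁
CoverableBy {n} {G = G} c d k =
  Σ (Fin k → Subgraph G) λ H →
    (∀ i → Monochromatic c (H i) × DiameterAtMost (H i) d) ×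
    (∀ (v : Fin n) → ∃ λ i → v ∈ vertices (H i))

AlwaysCoverableBy : (r d a k : ℕ) → Set₁
AlwaysCoverableBy r d a k =
  ∀ {n} (G : Graph n) → IsIndependenceNumber G a →
  (c : Colouring G r) → CoverableBy c d k

-- IsG r d a k says g(r, d, a) = k.
IsG : (r d a k : ℕ) → Set₁
IsG r d a = Least (AlwaysCoverableBy r d a)

{-# OPTIONS --safe #-}
-- The upper bound: the stars of each colour centred at the vertices of a maximum
-- independent set cover the graph.
--
-- The lower bound: colour K₄ by two paths P₄ (r = 2), respectively K₇ by the three
-- 7-cycles of differences ±1, ±2, ±3 modulo 7 (r = 3).  In both cases a monochromatic
-- subgraph of diameter at most 2 has at most 3 vertices, so as 4 > 3·1 and 7 > 3·2 a
-- clique needs r of them.  In a disjoint union of a such cliques no connected subgraph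
-- meets two cliques, so r·a subgraphs are needed.
module Submission where

open import Data.Nat using (ℕ; zero; suc; _+_; _≤_; _<_; z≤n; s≤s; _*_; _∸_; ∣_-_∣; _≤?_)
open import Data.Nat.Properties
  using (≤-refl; ≤-trans; ≤-antisym; <⇒≱; +-suc; +-monoˡ-≤; +-cancelˡ-<; *-comm; *-suc; *-mono-≤;
         ∸-monoʳ-<; ∣-∣-comm; anyUpTo?; module ≤-Reasoning)
open import Data.Fin using (Fin; zero; suc; toℕ; fromℕ<; quotient; remainder; remQuot; combine)
open import Data.Fin.Patterns using (0F; 1F; 2F)
open import Data.Fin.Properties
  using (_≟_; any?; all?; injective⇒≤; remQuot-combine; combine-remQuot; suc-injective)
open import Data.Fin.Subset
  using (Subset; inside; outside; _∈_; _∉_; ∣_∣; _∩_; _∪_; _─_; ⊤; ⁅_⁆)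
open import Data.Fin.Subset.Properties
  using (_∈?_; anySubset?; ∣⊤∣≡n; ∣p∩q∣≤∣q∣; p⊂q⇒∣p∣<∣q∣; p⊆p∪q; q⊆p∪q; x∈p∪q⁻; x∈⁅x⁆;
         x∈⁅y⁆⇒x≡y; p─q⊆p)
open import Data.Product using (Σ; ∃; _×_; _,_; proj₁; proj₂; uncurry)
open import Data.Sum using (_⊎_; inj₁; inj₂)
open import Data.Vec using ([]; _∷_; here; there; tabulate)
open import Data.Vec.Properties using (lookup∘tabulate; lookup⇒[]=; []=⇒lookup)
open import Function using (_∘_)
open import Function.Definitions using (Injective)
open import Relation.Binary.PropositionalEquality
  using (_≡_; _≢_; refl; sym; trans; cong; cong₂; subst; subst₂)
open import Relation.Nullary using (¬_; Dec; yes; no; does; contradiction)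
open import Relation.Nullary.Decidable
  using (map′; _×-dec_; _⊎-dec_; _→-dec_; ¬?; dec-true; decidable-stable; from-no)
open import Relation.Unary using (Pred; Decidable)
open import Level using (Level)
open import Defs

private
  variable
    ℓ : Level
    k m n r : ℕ

-- Subsets of Fin n

⟦_⟧ : {P : Pred (Fin n) ℓ} → Decidable P → Subset n
⟦ P? ⟧ = tabulate (does ∘ P?)

∈-⟦⟧⁺ : {P : Pred (Fin n) ℓ} (P? : Decidable P) → ∀ {x} → P x → x ∈ ⟦ P? ⟧
∈-⟦⟧⁺ P? {x} px =
  lookup⇒[]= x _ (trans (lookup∘tabulate (does ∘ P?) x) (dec-true (P? x) px))

∈-⟦⟧⁻ : {P : Pred (Fin n) ℓ} (P? : Decidable P) → ∀ {x} → x ∈ ⟦ P? ⟧ → P x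
∈-⟦⟧⁻ P? {x} x∈ with P? x | trans (sym (lookup∘tabulate (does ∘ P?) x)) ([]=⇒lookup x∈)
... | yes px | _ = px
... | no _   | ()

-- Together with `index` this identifies a subset with `Fin ∣ S ∣`, so that cardinality bounds
-- reduce to injections between `Fin` types.
element : (S : Subset n) → Fin ∣ S ∣ → Fin n
element (inside  ∷ S) zero    = zero
element (inside  ∷ S) (suc i) = suc (element S i)
element (outside ∷ S) i       = suc (element S i)

element-∈ : (S : Subset n) (i : Fin ∣ S ∣) → element S i ∈ S
element-∈ (inside  ∷ S) zero    = here
element-∈ (inside  ∷ S) (suc i) = there (element-∈ S i)
element-∈ (outside ∷ S) i       = there (element-∈ S i)

element-injective : (S : Subset n) → Injective _≡_ _≡_ (element S)
element-injective (inside  ∷ S) {zero}  {zero}  _  = refl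
element-injective (inside  ∷ S) {suc i} {suc j} eq =
  cong suc (element-injective S (suc-injective eq))
element-injective (outside ∷ S) eq = element-injective S (suc-injective eq)

index : {S : Subset n} {x : Fin n} → x ∈ S → Fin ∣ S ∣
index {S = inside  ∷ S} here      = zero
index {S = inside  ∷ S} (there p) = suc (index p)
index {S = outside ∷ S} (there p) = index p

element-index : {S : Subset n} {x : Fin n} (p : x ∈ S) → element S (index p) ≡ x
element-index {S = inside  ∷ S} here      = refl
element-index {S = inside  ∷ S} (there p) = cong suc (element-index p)
element-index {S = outside ∷ S} (there p) = cong suc (element-index p)

injective⇒≤∣S∣ : {S : Subset n} {f : Fin k → Fin n} →
  Injective _≡_ _≡_ f → (∀ i → f i ∈ S) → k ≤ ∣ S ∣
injective⇒≤∣S∣ {S = S} f-inj f∈S = injective⇒≤ {f = index ∘ f∈S} λ eq →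
  f-inj (trans (sym (element-index (f∈S _))) (trans (cong (element S) eq) (element-index (f∈S _))))

injectiveOn⇒∣S∣≤ : {S : Subset n} {f : Fin n → Fin k} →
  (∀ {x y} → x ∈ S → y ∈ S → f x ≡ f y → x ≡ y) → ∣ S ∣ ≤ k
injectiveOn⇒∣S∣≤ {S = S} {f} f-inj = injective⇒≤ {f = f ∘ element S} λ eq →
  element-injective S (f-inj (element-∈ S _) (element-∈ S _) eq)

∣p∩q∣+∣p─q∣≡∣p∣ : (p q : Subset n) → ∣ p ∩ q ∣ + ∣ p ─ q ∣ ≡ ∣ p ∣
∣p∩q∣+∣p─q∣≡∣p∣ []            []            = refl
∣p∩q∣+∣p─q∣≡∣p∣ (inside  ∷ p) (inside  ∷ q) = cong suc (∣p∩q∣+∣p─q∣≡∣p∣ p q)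
∣p∩q∣+∣p─q∣≡∣p∣ (inside  ∷ p) (outside ∷ q) =
  trans (+-suc _ _) (cong suc (∣p∩q∣+∣p─q∣≡∣p∣ p q))
∣p∩q∣+∣p─q∣≡∣p∣ (outside ∷ p) (inside  ∷ q) = ∣p∩q∣+∣p─q∣≡∣p∣ p q
∣p∩q∣+∣p─q∣≡∣p∣ (outside ∷ p) (outside ∷ q) = ∣p∩q∣+∣p─q∣≡∣p∣ p q

x∈p─q⇒x∉q : {p q : Subset n} {x : Fin n} → x ∈ p ─ q → x ∉ q
x∈p─q⇒x∉q {p = inside ∷ _} {outside ∷ _} here ()
x∈p─q⇒x∉q {p = _ ∷ _} {_ ∷ _} (there x∈) (there x∈q) = x∈p─q⇒x∉q x∈ x∈q

fibre : (Fin m → Fin k) → Fin k → Subset m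
fibre f j = ⟦ (λ x → f x ≟ j) ⟧

-- Greedy pigeonhole: pick a member of `T` and delete its whole fibre. This removes at most `s`
-- elements, so the strict inequality survives with `t` lowered by one.
distinctValues : (f : Fin m → Fin k) (s : ℕ) → (∀ j → ∣ fibre f j ∣ ≤ s) →
  ∀ t (T : Subset m) → s * t < ∣ T ∣ →
  Σ (Fin (suc t) → Fin m) λ g → (∀ i → g i ∈ T) × Injective _≡_ _≡_ (f ∘ g)
distinctValues f s small zero T st<∣T∣ =
  (λ _ → x) , (λ _ → element-∈ T _) , λ { {0F} {0F} _ → refl }
  where
  x = element T (fromℕ< st<∣T∣)
distinctValues {m} f s small (suc t) T st<∣T∣ = g , g∈T , g-inj
  where
  -- The strict bound shows that `T` is inhabited; any member would do, and this one has rank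
  -- `s * t`.
  x = element T (fromℕ< st<∣T∣)
  F = fibre f (f x)

  bound : s * t < ∣ T ─ F ∣
  bound = +-cancelˡ-< s (s * t) ∣ T ─ F ∣ (begin-strict
    s + s * t              ≡⟨ *-suc s t ⟨
    s * suc t              <⟨ st<∣T∣ ⟩
    ∣ T ∣                  ≡⟨ ∣p∩q∣+∣p─q∣≡∣p∣ T F ⟨
    ∣ T ∩ F ∣ + ∣ T ─ F ∣  ≤⟨ +-monoˡ-≤ _ (≤-trans (∣p∩q∣≤∣q∣ T F) (small (f x))) ⟩
    s + ∣ T ─ F ∣          ∎)
    where open ≤-Reasoning

  rest = distinctValues f s small t (T ─ F) bound
  h = proj₁ rest
  h∈T─F = proj₁ (proj₂ rest)

  g : Fin (suc (suc t)) → Fin m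
  g zero    = x
  g (suc i) = h i

  g∈T : ∀ i → g i ∈ T
  g∈T zero    = element-∈ T _
  g∈T (suc i) = p─q⊆p T F (h∈T─F i)

  fh≢fx : ∀ i → f (h i) ≢ f x
  fh≢fx i = x∈p─q⇒x∉q (h∈T─F i) ∘ ∈-⟦⟧⁺ (λ y → f y ≟ f x)

  g-inj : Injective _≡_ _≡_ (f ∘ g)
  g-inj {zero}  {zero}  _  = refl
  g-inj {zero}  {suc j} eq = contradiction (sym eq) (fh≢fx j)
  g-inj {suc i} {zero}  eq = contradiction eq (fh≢fx i)
  g-inj {suc i} {suc j} eq = cong suc (proj₂ (proj₂ rest) eq)

-- Distances and diameters

-- Linear search upwards from 0, shifting the predicate by `suc` after each failure.
least : {P : Pred ℕ ℓ} → Decidable P → ∀ k → P k → ∃ λ j → Least P j × j ≤ k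
least P? k pk with P? 0
least P? k       pk | yes p0 = 0 , (p0 , λ _ _ → z≤n) , z≤n
least P? zero    pk | no ¬p0 = contradiction pk ¬p0
least P? (suc k) pk | no ¬p0 with least (P? ∘ suc) k pk
... | j , (pj , j≤) , j≤k =
  suc j , (pj , λ { zero p0 → contradiction p0 ¬p0 ; (suc i) pi → s≤s (j≤ i pi) }) , s≤s j≤k

module _ {G : Graph n} (H : Subgraph G) where

  walk? : ∀ u v l → Dec (Walk H u v l)
  walk? u v zero = map′ (λ { (refl , v∈) → [] v∈ }) (λ { ([] v∈) → refl , v∈ })
                        ((u ≟ v) ×-dec (v ∈? vertices H))
  walk? u v (suc l) = map′ (λ { (w , e , p) → e ∷ p }) (λ { (e ∷ p) → _ , e , p })
                           (any? λ w → edge? H u w ×-dec walk? w v l)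

  distanceAtMost : ∀ {u v l d} → Walk H u v l → l ≤ d → DistanceAtMost H u v d
  distanceAtMost {u} {v} {l} p l≤d with least (walk? u v) l p
  ... | k , dist , k≤l = k , dist , ≤-trans k≤l l≤d

  distanceAtMost? : ∀ u v d → Dec (DistanceAtMost H u v d)
  distanceAtMost? u v d =
    map′ (λ { (l , s≤s l≤d , p) → distanceAtMost p l≤d })
         (λ { (l , (p , _) , l≤d) → l , s≤s l≤d , p })
         -- `anyUpTo?` searches strictly below its bound, hence `suc d`.
         (anyUpTo? (walk? u v) (suc d))

  -- `DiameterAtMost` asks for the exact diameter. Finiteness makes each candidate bound decidable,
  -- so the least one can be searched for below `d`.
  diameterAtMost : ∀ {d} →
    (∀ u v → u ∈ vertices H → v ∈ vertices H → ∃ λ l → Walk H u v l × l ≤ d) →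
    DiameterAtMost H d
  diameterAtMost {d} walk = least
    (λ k → all? λ u → all? λ v →
      (u ∈? vertices H) →-dec ((v ∈? vertices H) →-dec distanceAtMost? u v k))
    d λ u v u∈ v∈ → let _ , p , l≤d = walk u v u∈ v∈ in distanceAtMost p l≤d

  diameterAtMost⇒walk : ∀ {u v d} → DiameterAtMost H d → u ∈ vertices H → v ∈ vertices H →
    ∃ λ l → Walk H u v l × l ≤ d
  diameterAtMost⇒walk {u} {v} (k , (dist , _) , k≤d) u∈ v∈ with dist u v u∈ v∈
  ... | l , (p , _) , l≤k = l , p , ≤-trans l≤k k≤d

-- Stars

module _ {G : Graph n} (c : Colouring G r) (s : Fin n) (κ : Fin r) where

  Leaf : Fin n → Set
  Leaf v = Σ (Adj G s v) λ p → colour c p ≡ κ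

  -- Both colours agree with that of the reversed edge.
  colour-irrelevant : ∀ {u v} (p q : Adj G u v) → colour c p ≡ colour c q
  colour-irrelevant p q = trans (colour-sym c p (adj-sym G p)) (colour-sym c (adj-sym G p) q)

  leaf? : Decidable Leaf
  leaf? v with adj? G s v
  ... | no ¬p = no (¬p ∘ proj₁)
  ... | yes p = map′ (p ,_) (λ { (q , eq) → trans (colour-irrelevant p q) eq }) (colour c p ≟ κ)

  inStar? : Decidable λ v → v ≡ s ⊎ Leaf v
  inStar? v = (v ≟ s) ⊎-dec leaf? v

  star : Subgraph G
  star = record
    { vertices = ⟦ inStar? ⟧
    -- The centre is always included, so the star is legitimate even when no edge of colour `κ`
    -- meets `s`.
    ; nonempty = s , ∈-⟦⟧⁺ inStar? (inj₁ refl)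
    ; Edge     = λ u v → (u ≡ s × Leaf v) ⊎ (v ≡ s × Leaf u)
    ; edge?    = λ u v → ((u ≟ s) ×-dec leaf? v) ⊎-dec ((v ≟ s) ×-dec leaf? u)
    ; edge-sym = λ { (inj₁ e) → inj₂ e ; (inj₂ e) → inj₁ e }
    ; edge-end = λ
      { (inj₁ (u≡s , v-leaf)) → ∈-⟦⟧⁺ inStar? (inj₁ u≡s) , ∈-⟦⟧⁺ inStar? (inj₂ v-leaf)
      ; (inj₂ (v≡s , u-leaf)) → ∈-⟦⟧⁺ inStar? (inj₂ u-leaf) , ∈-⟦⟧⁺ inStar? (inj₁ v≡s) }
    ; edge-adj = λ { (inj₁ (refl , p , _)) → p ; (inj₂ (refl , p , _)) → adj-sym G p }
    }

  star-colour : ∀ {u v} (e : Edge star u v) → colour c (edge-adj star e) ≡ κ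
  star-colour (inj₁ (refl , p , eq)) = eq
  star-colour (inj₂ (refl , p , eq)) = trans (colour-sym c (adj-sym G p) p) eq

  star-monochromatic : Monochromatic c star
  star-monochromatic e f = trans (star-colour e) (sym (star-colour f))

  star-diameter : DiameterAtMost star 2
  star-diameter = diameterAtMost star λ u v u∈ v∈ → walk u∈ v∈ (∈-⟦⟧⁻ inStar? u∈) (∈-⟦⟧⁻ inStar? v∈)
    where
    walk : ∀ {u v} → u ∈ vertices star → v ∈ vertices star →
      u ≡ s ⊎ Leaf u → v ≡ s ⊎ Leaf v → ∃ λ l → Walk star u v l × l ≤ 2
    walk u∈ v∈ (inj₁ refl) (inj₁ refl) = 0 , [] v∈ , z≤n
    walk u∈ v∈ (inj₁ refl) (inj₂ q)    = 1 , inj₁ (refl , q) ∷ [] v∈ , s≤s z≤n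
    walk u∈ v∈ (inj₂ p)    (inj₁ refl) = 1 , inj₂ (refl , p) ∷ [] v∈ , s≤s z≤n
    walk u∈ v∈ (inj₂ p)    (inj₂ q)    =
      2 , inj₂ (refl , p) ∷ inj₁ (refl , q) ∷ [] v∈ , s≤s (s≤s z≤n)

-- A vertex neither in `S` nor adjacent to a member of `S` could be added to `S`, giving a larger
-- independent set.
maximum-dominates : (G : Graph n) (S : Subset n) → Independent G S →
  (∀ T → Independent G T → ∣ T ∣ ≤ ∣ S ∣) →
  ∀ v → ∃ λ s → s ∈ S × (v ≡ s ⊎ Adj G s v)
maximum-dominates {n} G S S-ind S-max v =
  decidable-stable (any? λ s → (s ∈? S) ×-dec ((v ≟ s) ⊎-dec adj? G s v)) λ undominated →
    <⇒≱ (p⊂q⇒∣p∣<∣q∣ (p⊆p∪q ⁅ v ⁆ , v , q⊆p∪q S ⁅ v ⁆ (x∈⁅x⁆ v) ,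
                     λ v∈S → undominated (v , v∈S , inj₁ refl)))
        (S-max (S ∪ ⁅ v ⁆) (extended undominated))
  where
  extended : ¬ (∃ λ s → s ∈ S × (v ≡ s ⊎ Adj G s v)) → Independent G (S ∪ ⁅ v ⁆)
  extended undominated {x} {y} x∈ y∈ xy with x∈p∪q⁻ S ⁅ v ⁆ x∈ | x∈p∪q⁻ S ⁅ v ⁆ y∈
  ... | inj₁ x∈S | inj₁ y∈S = S-ind x∈S y∈S xy
  ... | inj₁ x∈S | inj₂ y∈v with refl ← x∈⁅y⁆⇒x≡y v y∈v = undominated (x , x∈S , inj₂ xy)
  ... | inj₂ x∈v | inj₁ y∈S with refl ← x∈⁅y⁆⇒x≡y v x∈v =
    undominated (y , y∈S , inj₂ (adj-sym G xy))
  ... | inj₂ x∈v | inj₂ y∈v with refl ← x∈⁅y⁆⇒x≡y v x∈v | refl ← x∈⁅y⁆⇒x≡y v y∈v = adj-irr G xy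

stars-cover : ∀ r a → AlwaysCoverableBy (suc r) 2 a (suc r * a)
stars-cover r a G ((S , S-ind , refl) , S-max) c =
  uncurry H ∘ remQuot a ,
  (λ i → let κ , j = remQuot {suc r} a i in
    star-monochromatic c (element S j) κ , star-diameter c (element S j) κ) ,
  covered
  where
  H : Fin (suc r) → Fin a → Subgraph G
  H κ j = star c (element S j) κ

  in-cover : ∀ {v} κ j → v ∈ vertices (H κ j) →
    ∃ λ i → v ∈ vertices (uncurry H (remQuot a i))
  in-cover {v} κ j v∈ = combine κ j ,
    subst (λ p → v ∈ vertices (uncurry H p)) (sym (remQuot-combine κ j)) v∈

  covered : ∀ v → ∃ λ i → v ∈ vertices (uncurry H (remQuot a i))
  covered v with maximum-dominates G S S-ind S-max v
  ... | s , s∈S , d with index s∈S | element-index s∈S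
  -- The centre lies in its stars of all colours; `0F` is an arbitrary choice.
  covered v | s , s∈S , inj₁ v≡s | j | refl =
    in-cover 0F j (∈-⟦⟧⁺ (inStar? c s 0F) (inj₁ v≡s))
  covered v | s , s∈S , inj₂ p | j | refl =
    in-cover (colour c p) j (∈-⟦⟧⁺ (inStar? c s (colour c p)) (inj₂ (p , refl)))

-- Disjoint unions of coloured cliques

-- An edgeless subgraph has no colour of its own and gets the default `0F`.
monochromatic⇒colour : {G : Graph n} (c : Colouring G (suc r)) (H : Subgraph G) →
  Monochromatic c H → ∃ λ κ → ∀ {u v} (e : Edge H u v) → colour c (edge-adj H e) ≡ κ
monochromatic⇒colour c H mono with any? (λ u → any? λ v → edge? H u v)
... | yes (_ , _ , e) = colour c (edge-adj H e) , λ f → mono f e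
... | no edgeless     = 0F , λ e → contradiction (_ , _ , e) edgeless

-- There are `a` disjoint copies of the complete graph on `m` vertices, all coloured alike. Letting
-- the colour depend only on the difference of positions makes it symmetric for free.
module CliqueUnion (a m : ℕ) {t : ℕ} (δ : ℕ → Fin (suc t)) where

  col : Fin m → Fin m → Fin (suc t)
  col x y = δ ∣ toℕ x - toℕ y ∣

  col-sym : ∀ x y → col x y ≡ col y x
  col-sym x y = cong δ (∣-∣-comm (toℕ x) (toℕ y))

  clique : Fin (a * m) → Fin a
  clique = quotient m

  position : Fin (a * m) → Fin m
  position = remainder {a} m

  clique-combine : ∀ b x → clique (combine {a} b x) ≡ b
  clique-combine b x = cong proj₁ (remQuot-combine b x)

  position-combine : ∀ b x → position (combine {a} b x) ≡ x
  position-combine b x = cong proj₂ (remQuot-combine b x)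

  clique-position-injective : ∀ {u v} → clique u ≡ clique v → position u ≡ position v → u ≡ v
  clique-position-injective {u} {v} eq₁ eq₂ =
    trans (sym (combine-remQuot {a} m u)) (trans (cong₂ combine eq₁ eq₂) (combine-remQuot {a} m v))

  graph : Graph (a * m)
  graph = record
    { Adj     = λ u v → clique u ≡ clique v × u ≢ v
    ; adj?    = λ u v → (clique u ≟ clique v) ×-dec ¬? (u ≟ v)
    ; adj-sym = λ { (eq , u≢v) → sym eq , u≢v ∘ sym }
    ; adj-irr = λ { (_ , v≢v) → v≢v refl }
    }

  colouring : Colouring graph (suc t)
  colouring = record
    { colour     = λ {u} {v} _ → col (position u) (position v)
    ; colour-sym = λ {u} {v} _ _ → col-sym (position u) (position v)
    }

  independent⇒∣S∣≤a : ∀ S → Independent graph S → ∣ S ∣ ≤ a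
  independent⇒∣S∣≤a S ind = injectiveOn⇒∣S∣≤ {f = clique} λ {u} {v} u∈ v∈ eq →
    decidable-stable (u ≟ v) λ u≢v → ind u∈ v∈ (eq , u≢v)

  -- The vertices at position `x`, one from each clique, attain the bound.
  independenceNumber : Fin m → IsIndependenceNumber graph a
  independenceNumber x =
    (S , S-ind , ≤-antisym (independent⇒∣S∣≤a S S-ind) a≤∣S∣) , independent⇒∣S∣≤a
    where
    S? : Decidable λ v → position v ≡ x
    S? v = position v ≟ x

    S = ⟦ S? ⟧

    S-ind : Independent graph S
    S-ind u∈ v∈ (eq , u≢v) =
      u≢v (clique-position-injective eq (trans (∈-⟦⟧⁻ S? u∈) (sym (∈-⟦⟧⁻ S? v∈))))

    a≤∣S∣ : a ≤ ∣ S ∣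
    a≤∣S∣ = injective⇒≤∣S∣ {f = λ b → combine {a} b x}
      (λ eq → trans (sym (clique-combine _ x)) (trans (cong clique eq) (clique-combine _ x)))
      (λ b → ∈-⟦⟧⁺ S? (position-combine b x))

  -- The values col x x are junk, but harmless: w = x and w = y yield nothing new.
  Near : Fin (suc t) → Fin m → Fin m → Set
  Near κ x y = x ≡ y ⊎ col x y ≡ κ ⊎ ∃ λ w → col x w ≡ κ × col w y ≡ κ

  near? : ∀ κ x y → Dec (Near κ x y)
  near? κ x y = (x ≟ y) ⊎-dec ((col x y ≟ κ) ⊎-dec any? λ w → (col x w ≟ κ) ×-dec (col w y ≟ κ))

  -- The middle vertex in `Near` may lie outside `S`, since `S` will be only part of the vertex set
  -- of a covering subgraph.
  NearSet : Fin (suc t) → Subset m → Set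
  NearSet κ S = ∀ x y → x ∈ S → y ∈ S → Near κ x y

  nearSet? : ∀ κ S → Dec (NearSet κ S)
  nearSet? κ S = all? λ x → all? λ y → (x ∈? S) →-dec ((y ∈? S) →-dec near? κ x y)

  -- The existence of a counterexample to the size bound, in a form that can be decided by
  -- enumerating subsets.
  LargeNearSet : ℕ → Fin (suc t) → Set
  LargeNearSet s κ = ∃ λ S → NearSet κ S × ¬ ∣ S ∣ ≤ s

  largeNearSet? : ∀ s κ → Dec (LargeNearSet s κ)
  largeNearSet? s κ = anySubset? λ S → nearSet? κ S ×-dec ¬? (∣ S ∣ ≤? s)

  module _ {H : Subgraph graph} where

    walk⇒clique≡ : ∀ {u v l} → Walk H u v l → clique u ≡ clique v
    walk⇒clique≡ ([] _)  = refl
    walk⇒clique≡ (e ∷ p) = trans (proj₁ (edge-adj H e)) (walk⇒clique≡ p)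

    walk⇒near : ∀ {κ u v l} → (∀ {x y} (e : Edge H x y) → colour colouring (edge-adj H e) ≡ κ) →
      Walk H u v l → l ≤ 2 → Near κ (position u) (position v)
    walk⇒near mono ([] _)              _ = inj₁ refl
    walk⇒near mono (e ∷ [] _)          _ = inj₂ (inj₁ (mono e))
    walk⇒near mono (e ∷ (f ∷ [] _))    _ = inj₂ (inj₂ (_ , mono e , mono f))
    walk⇒near mono (_ ∷ (_ ∷ (_ ∷ _))) (s≤s (s≤s ()))

  -- Let `f` choose a covering subgraph for each vertex. Within a clique each subgraph is chosen at
  -- most `s` times, so at least `suc t` are chosen; distinct cliques share none. Pairs of a clique
  -- and a representative therefore inject into `Fin k`.
  cover-size≥ : (s : ℕ) → (∀ κ → ¬ LargeNearSet s κ) → s * t < m →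
    ∀ {k} → CoverableBy colouring 2 k → a * suc t ≤ k
  cover-size≥ s none st<m {k} (H , good , covers) =
    injective⇒≤ {f = uncurry value ∘ remQuot (suc t)} λ {i} {j} eq →
      trans (sym (combine-remQuot {a} (suc t) i))
        (trans (cong (uncurry combine) (value-injective {remQuot (suc t) i} eq))
          (combine-remQuot {a} (suc t) j))
    where
    f : Fin a → Fin m → Fin k
    f b x = proj₁ (covers (combine {a} b x))

    ∈H : ∀ b x {i} → f b x ≡ i → combine b x ∈ vertices (H i)
    ∈H b x refl = proj₂ (covers (combine b x))

    -- Finite diameter makes the common subgraph connected, and its walks never leave a clique.
    same-clique : ∀ {b b′ x x′} → f b x ≡ f b′ x′ → b ≡ b′
    same-clique {b} {b′} {x} {x′} eq
      with _ , p , _ ← diameterAtMost⇒walk (H _) (proj₂ (good _)) (∈H b x eq) (∈H b′ x′ refl) =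
      trans (sym (clique-combine b x)) (trans (walk⇒clique≡ p) (clique-combine b′ x′))

    -- The fibre lies in the single subgraph `H i`, whose walks of length at most 2 in one colour
    -- make its positions pairwise near.
    fibre-small : ∀ b i → ∣ fibre (f b) i ∣ ≤ s
    fibre-small b i with κ , mono ← monochromatic⇒colour colouring (H i) (proj₁ (good i)) =
      decidable-stable (_ ≤? s) λ large → none κ (fibre (f b) i , (λ x y x∈ y∈ →
        let _ , p , l≤2 = diameterAtMost⇒walk (H i) (proj₂ (good i))
                            (∈H b x (∈-⟦⟧⁻ (λ z → f b z ≟ i) x∈))
                            (∈H b y (∈-⟦⟧⁻ (λ z → f b z ≟ i) y∈))
        in subst₂ (Near κ) (position-combine b x) (position-combine b y)
             (walk⇒near mono p l≤2)) , large)

    representatives : ∀ b → Σ (Fin (suc t) → Fin m) λ g →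
      (∀ i → g i ∈ ⊤) × Injective _≡_ _≡_ (f b ∘ g)
    representatives b = distinctValues (f b) s (fibre-small b) t ⊤
      (subst (s * t <_) (sym (∣⊤∣≡n m)) st<m)

    value : Fin a → Fin (suc t) → Fin k
    value b i = f b (proj₁ (representatives b) i)

    value-injective : ∀ {p q : Fin a × Fin (suc t)} → uncurry value p ≡ uncurry value q → p ≡ q
    -- The cliques are identified first, so that `i` and `j` index the same family of
    -- representatives.
    value-injective {b , i} {b′ , j} eq with refl ← same-clique {b} {b′} eq =
      cong (b ,_) (proj₂ (proj₂ (representatives b)) eq)

  g≡[1+t]a : ∀ s → (∀ κ → ¬ LargeNearSet s κ) → s * t < m → 1 ≤ a →
    IsG (suc t) 2 a (suc t * a) ×
    (Σ ℕ λ n → Σ (Graph n) λ G → IsIndependenceNumber G a ×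
      (Σ (Colouring G (suc t)) λ c → ¬ CoverableBy c 2 (suc t * a ∸ 1)))
  g≡[1+t]a s none st<m 1≤a =
    (stars-cover t a , λ j always → lower (always graph α≡a colouring)) ,
    _ , graph , α≡a , colouring ,
    λ cover → <⇒≱ (∸-monoʳ-< {suc t * a} (s≤s z≤n) 1≤[1+t]a) (lower cover)
    where
    -- The strict bound also supplies a position, as `m` is positive.
    α≡a = independenceNumber (fromℕ< st<m)

    -- Positivity makes the truncated subtraction `∸ 1` a strict decrease.
    1≤[1+t]a : 1 ≤ suc t * a
    1≤[1+t]a = *-mono-≤ {1} {suc t} (s≤s z≤n) 1≤a

    lower : ∀ {k} → CoverableBy colouring 2 k → suc t * a ≤ k
    lower {k} = subst (_≤ k) (*-comm a (suc t)) ∘ cover-size≥ s none st<m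

-- The edge xy has colour paths ∣ x - y ∣, which gives the paths 0-1-2-3 and 2-0-3-1.
paths : ℕ → Fin 2
paths 1 = 0F
paths _ = 1F

-- The 7-cycles of differences ±1, ±2, ±3 modulo 7.
cycles : ℕ → Fin 3
cycles 1 = 0F
cycles 6 = 0F
cycles 2 = 1F
cycles 5 = 1F
cycles _ = 2F

mainTheorem5 : (r a : ℕ) → r ≡ 2 ⊎ r ≡ 3 → 1 ≤ a →
    IsG r 2 a (r * a) ×
    (Σ ℕ λ n → Σ (Graph n) λ G → IsIndependenceNumber G a ×
    (Σ (Colouring G r) λ c → ¬ CoverableBy c 2 (r * a ∸ 1)))
-- Here `s * t < m` reads 3 · 1 < 4, and below 3 · 2 < 7. Both are tight, so `≤-refl` proves them.
mainTheorem5 .2 a (inj₁ refl) = g≡[1+t]a 3 none ≤-refl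
  where
  open CliqueUnion a 4 paths

  -- The ends of a path on four vertices are at distance 3, which excludes the full set; evaluation
  -- over all subsets confirms this.
  none : ∀ κ → ¬ LargeNearSet 3 κ
  none 0F = from-no (largeNearSet? 3 0F)
  none 1F = from-no (largeNearSet? 3 1F)
mainTheorem5 .3 a (inj₂ refl) = g≡[1+t]a 3 none ≤-refl
  where
  open CliqueUnion a 7 cycles

  -- The pairs at distance 3 in a 7-cycle form another 7-cycle, whose independent sets have at most
  -- 3 vertices. The check is again by evaluation over all subsets.
  none : ∀ κ → ¬ LargeNearSet 3 κ
  none 0F = from-no (largeNearSet? 3 0F)
  none 1F = from-no (largeNearSet? 3 1F)
  none 2F = from-no (largeNearSet? 3 2F)
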